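{- In the "all violated constraints" model, hidden 2SAT can be solved in polynomial time: there is an algorithm which, given oracle access to a hidden 2SAT instance on $n$ variables and $m$ clauses, finds a satisfying assignment if one exists, and otherwise determines that the instance is unsatisfiable, in time polynomial in $n$ and $m$.
   Context: A SAT formula on Boolean variables $x_1,\dots,x_n$ is a conjunction of clauses $C_1,\dots,C_m$; each clause is a disjunction of literals ($x_i$ or $\overline{x}_i$) on pairwise distinct variables. It is a 2SAT instance if every clause has at most $2$ literals. Clauses with the same set of literals may occur several times. "All violated constraints" model: the formula is hidden, and the algorithm accesses it only through an oracle. A query is an assignment $\mathbf{x}\in\{0,1\}^n$, and the oracle returns the set of indices $j\in[m]$ of all clauses $C_j$ violated (evaluated to $0$) by $\mathbf{x}$; in particular, if this set is empty then $\mathbf{x}$ is a satisfying assignment. Running time is total running time, with each oracle query costing unit time. -}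

module Defs where

open import Data.Bool.Base using (Bool; true; false; not; if_then_else_)
open import Data.Bool.ListAction using (any)
open import Data.Fin.Base using (Fin; toℕ)
open import Data.Fin.Subset using (Subset)
open import Data.List.Base using (List; length; map)
open import Data.List.Relation.Unary.Unique.Propositional using (Unique)
open import Data.Nat.Base using (ℕ; zero; suc; _+_; _*_; _∸_; _≤_; _≡ᵇ_; _<ᵇ_)
open import Data.Product.Base using (∃; _×_)
open import Data.Vec.Base using ([]; _∷_; tabulate)
open import Data.Vec.Functional using (Vector)
open import Relation.Binary.PropositionalEquality.Core using (_≡_; _≢_)
open import Relation.Nullary.Negation.Core using (¬_)

data Literal (n : ℕ) : Set where
  pos neg : Fin n → Literal n

variableOf : ∀ {n} → Literal n → Fin n
variableOf (pos i) = i
variableOf (neg i) = i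

record Clause (n : ℕ) : Set where
  field
    literals : List (Literal n)
    distinct : Unique (map variableOf literals)

open Clause public

-- Clauses are indexed, so the same clause may occur several times.
Formula : ℕ → ℕ → Set
Formula n m = Vector (Clause n) m

Is2SAT : ∀ {n m} → Formula n m → Set
Is2SAT Φ = ∀ j → length (literals (Φ j)) ≤ 2

Assignment : ℕ → Set
Assignment n = Vector Bool n

evalLiteral : ∀ {n} → Assignment n → Literal n → Bool
evalLiteral x (pos i) = x i
evalLiteral x (neg i) = not (x i)

evalClause : ∀ {n} → Assignment n → Clause n → Bool
evalClause x C = any (evalLiteral x) (literals C)

Satisfies : ∀ {n m} → Formula n m → Assignment n → Set
Satisfies Φ x = ∀ j → evalClause x (Φ j) ≡ true

Satisfiable : ∀ {n m} → Formula n m → Set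
Satisfiable Φ = ∃ λ x → Satisfies Φ x

Oracle : ℕ → ℕ → Set
Oracle n m = Assignment n → Subset m

violated : ∀ {n m} → Formula n m → Oracle n m
violated Φ x = tabulate λ j → not (evalClause x (Φ j))

-- While programs over natural-number registers and
-- arrays, both named by natural numbers.
--
-- The only arithmetic is addition and truncated subtraction.  With
-- multiplication at unit cost, numbers of exponential bit length could be
-- built in polynomial time; without it, bit lengths grow by at most one
-- per time unit, so unit-cost time is polynomially related to Turing
-- machine time.

infixl 6 _⊕_ _⊖_
infix  5 _≔_ _[_]≔_ _≔query_
infixr 4 _⨾_

data Expr : Set where
  lit     : ℕ → Expr
  reg     : ℕ → Expr
  arr     : ℕ → Expr → Expr
  _⊕_ _⊖_ : Expr → Expr → Expr

data Program : Set where
  skip          : Program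
  _≔_           : ℕ → Expr → Program
  _[_]≔_        : ℕ → Expr → Expr → Program
  -- b ≔query a  submits the assignment held in array a and stores the
  -- oracle's answer in array b.
  _≔query_      : ℕ → ℕ → Program
  _⨾_           : Program → Program → Program
  ifNZ_then_else_ : Expr → Program → Program → Program
  whileNZ_loop_   : Expr → Program → Program

record State : Set where
  constructor state
  field
    regs : ℕ → ℕ
    arrs : ℕ → ℕ → ℕ

open State public

update : {A : Set} → (ℕ → A) → ℕ → A → (ℕ → A)
update f i v j = if i ≡ᵇ j then v else f j

setReg : State → ℕ → ℕ → State
setReg s r v = state (update (regs s) r v) (arrs s)

setArr : State → ℕ → (ℕ → ℕ) → State
setArr s a f = state (regs s) (update (arrs s) a f)

⟦_⟧ : Expr → State → ℕ
⟦ lit k   ⟧ s = k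
⟦ reg r   ⟧ s = regs s r
⟦ arr a e ⟧ s = arrs s a (⟦ e ⟧ s)
⟦ d ⊕ e   ⟧ s = ⟦ d ⟧ s + ⟦ e ⟧ s
⟦ d ⊖ e   ⟧ s = ⟦ d ⟧ s ∸ ⟦ e ⟧ s

cost : Expr → ℕ
cost (lit k)   = 1
cost (reg r)   = 1
cost (arr a e) = suc (cost e)
cost (d ⊕ e)   = suc (cost d + cost e)
cost (d ⊖ e)   = suc (cost d + cost e)

-- Cell i holds the value of variable i; any nonzero number means true.
decodeAssignment : ∀ {n} → (ℕ → ℕ) → Assignment n
decodeAssignment f i = 0 <ᵇ f (toℕ i)

-- Characteristic function of a set of clause indices, 0 from m onwards.
encodeSubset : ∀ {m} → Subset m → ℕ → ℕ
encodeSubset []      _       = 0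
encodeSubset (b ∷ p) zero    = if b then 1 else 0
encodeSubset (b ∷ p) (suc j) = encodeSubset p j

-- O ⊢ P ∶ s ⇓ s′ ⟨ t ⟩: with oracle O, started in state s, the program P
-- halts in state s′ after exactly t time units.
infix 3 _⊢_∶_⇓_⟨_⟩

data _⊢_∶_⇓_⟨_⟩ {n m} (O : Oracle n m) :
     Program → State → State → ℕ → Set where

  ⇓skip : ∀ {s} → O ⊢ skip ∶ s ⇓ s ⟨ 1 ⟩

  ⇓assign : ∀ {s r e} →
    O ⊢ r ≔ e ∶ s ⇓ setReg s r (⟦ e ⟧ s) ⟨ suc (cost e) ⟩

  ⇓store : ∀ {s a d e} →
    O ⊢ a [ d ]≔ e ∶ s
      ⇓ setArr s a (update (arrs s a) (⟦ d ⟧ s) (⟦ e ⟧ s))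
      ⟨ suc (cost d + cost e) ⟩

  ⇓query : ∀ {s a b} →
    O ⊢ b ≔query a ∶ s
      ⇓ setArr s b (encodeSubset (O (decodeAssignment (arrs s a))))
      ⟨ 1 ⟩

  ⇓seq : ∀ {P Q s s′ s″ t u} →
    O ⊢ P ∶ s ⇓ s′ ⟨ t ⟩ →
    O ⊢ Q ∶ s′ ⇓ s″ ⟨ u ⟩ →
    O ⊢ P ⨾ Q ∶ s ⇓ s″ ⟨ t + u ⟩

  ⇓then : ∀ {e P Q s s′ t} →
    ⟦ e ⟧ s ≢ 0 →
    O ⊢ P ∶ s ⇓ s′ ⟨ t ⟩ →
    O ⊢ ifNZ e then P else Q ∶ s ⇓ s′ ⟨ suc (cost e + t) ⟩

  ⇓else : ∀ {e P Q s s′ t} →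
    ⟦ e ⟧ s ≡ 0 →
    O ⊢ Q ∶ s ⇓ s′ ⟨ t ⟩ →
    O ⊢ ifNZ e then P else Q ∶ s ⇓ s′ ⟨ suc (cost e + t) ⟩

  ⇓stop : ∀ {e P s} →
    ⟦ e ⟧ s ≡ 0 →
    O ⊢ whileNZ e loop P ∶ s ⇓ s ⟨ suc (cost e) ⟩

  ⇓loop : ∀ {e P s s′ s″ t u} →
    ⟦ e ⟧ s ≢ 0 →
    O ⊢ P ∶ s ⇓ s′ ⟨ t ⟩ →
    O ⊢ whileNZ e loop P ∶ s′ ⇓ s″ ⟨ u ⟩ →
    O ⊢ whileNZ e loop P ∶ s ⇓ s″ ⟨ suc (cost e + t + u) ⟩

-- The input: n in register 0 and m in register 1.
initial : ℕ → ℕ → State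
initial n m = state (update (update (λ _ → 0) 0 n) 1 m) (λ _ _ → 0)

-- The output: register 0 is 1 for "satisfiable", with a satisfying
-- assignment in array 0, and 0 for "unsatisfiable".
CorrectOutput : ∀ {n m} → Formula n m → State → Set
CorrectOutput Φ s =
  (Satisfiable Φ → regs s 0 ≡ 1 × Satisfies Φ (decodeAssignment (arrs s 0))) ×
  (¬ Satisfiable Φ → regs s 0 ≡ 0)

infixl 6 _:+_
infixl 7 _:*_

data Polynomial : Set where
  con       : ℕ → Polynomial
  X Y       : Polynomial
  _:+_ _:*_ : Polynomial → Polynomial → Polynomial

evalPoly : Polynomial → ℕ → ℕ → ℕ
evalPoly (con c)  x y = c
evalPoly X        x y = x
evalPoly Y        x y = y
evalPoly (p :+ q) x y = evalPoly p x y + evalPoly q x y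
evalPoly (p :* q) x y = evalPoly p x y * evalPoly q x y

{-# OPTIONS --safe #-}
module Submission where

-- A partial assignment is kept as a pair of total ones, agreeing exactly on
-- the assigned variables.  A clause violated by both members has all its
-- literals assigned and false, so two queries decide whether a partial
-- assignment falsifies a clause, and trying both values of each unassigned
-- variable performs unit propagation without ever learning the clauses.
-- The variables are decided one by one: x_i is set to 1, this is propagated
-- by n passes over the variables, and x_i is reset to 0 on a conflict.  If
-- there is no conflict, the propagated partial assignment satisfies every
-- clause it touches (this is where 2SAT is used), so it extends to a model
-- as soon as the formula has one; a conflict means that no model extends the
-- choices made with x_i = 1.

open import Defs
open import Data.Bool.Base using (Bool; true; false; not; _∧_; _∨_; if_then_else_)
open import Data.Bool.ListAction using (any)
open import Data.Bool.Properties
  using (∨-conicalˡ; ∨-conicalʳ; ∧-conicalˡ; ∧-conicalʳ; ¬-not; not-injective)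
  renaming (_≟_ to _≟ᵇ_)
open import Data.Fin.Base using (Fin; zero; suc; toℕ; fromℕ<)
open import Data.Fin.Properties using (_≟_; toℕ-injective; toℕ<n; toℕ-fromℕ<)
open import Data.Fin.Subset using (Subset)
open import Data.List.Base using ([]; _∷_; length)
open import Data.Nat.Base
  using (ℕ; zero; suc; _+_; _*_; _∸_; _≤_; _<_; _≡ᵇ_; _<ᵇ_; z≤n; s≤s; s≤s⁻¹)
open import Data.Nat.Properties hiding (_≟_)
open import Data.Nat.Solver using (module +-*-Solver)
open import Data.Product.Base using (Σ-syntax; ∃-syntax; _×_; _,_; proj₁; proj₂; map₁; map₂)
open import Data.Sum.Base using (_⊎_; inj₁; inj₂) renaming (map to map⊎)
open import Data.Vec.Base using (_∷_; lookup)
open import Data.Vec.Properties using (lookup∘tabulate)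
open import Function.Base using (_∘_)
open import Relation.Binary.PropositionalEquality
  using (_≡_; _≢_; _≗_; refl; sym; trans; cong; cong-app; cong₂; subst; subst₂)
open import Relation.Nullary.Decidable.Core using (yes; no; does)
open import Relation.Nullary.Negation using (¬_; contradiction)

-- Bounded loop programs

≡ᵇ-refl : ∀ i → (i ≡ᵇ i) ≡ true
≡ᵇ-refl zero    = refl
≡ᵇ-refl (suc i) = ≡ᵇ-refl i

≢⇒≡ᵇ-false : ∀ {i j} → i ≢ j → (i ≡ᵇ j) ≡ false
≢⇒≡ᵇ-false {zero}  {zero}  i≢j = contradiction refl i≢j
≢⇒≡ᵇ-false {zero}  {suc j} i≢j = refl
≢⇒≡ᵇ-false {suc i} {zero}  i≢j = refl
≢⇒≡ᵇ-false {suc i} {suc j} i≢j = ≢⇒≡ᵇ-false (i≢j ∘ cong suc)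

update-updates : ∀ {A : Set} (f : ℕ → A) i {x} → update f i x i ≡ x
update-updates f i rewrite ≡ᵇ-refl i = refl

update-minimal : ∀ {A : Set} (f : ℕ → A) {i j x} → i ≢ j → update f i x j ≡ f j
update-minimal f i≢j rewrite ≢⇒≡ᵇ-false i≢j = refl

data Size : Set where
  #variables #clauses : Size

sizeRegister : Size → ℕ
sizeRegister #variables = 0
sizeRegister #clauses   = 1

sizeValue : Size → ℕ → ℕ → ℕ
sizeValue #variables n m = n
sizeValue #clauses   n m = m

sizePolynomial : Size → Polynomial
sizePolynomial #variables = X
sizePolynomial #clauses   = Y

infixr 4 _⟫_

data Command : Set where
  set               : ℕ → Expr → Command
  store             : ℕ → Expr → Expr → Command
  query             : ℕ → ℕ → Command
  _⟫_               : Command → Command → Command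
  when              : Expr → Command → Command
  for_below_repeat_ : ℕ → Size → Command → Command

compile : Command → Program
compile (set r e)         = r ≔ e
compile (store a d e)     = a [ d ]≔ e
compile (query b a)       = b ≔query a
compile (P ⟫ Q)           = compile P ⨾ compile Q
compile (when e P)        = ifNZ e then compile P else skip
compile (for r below z repeat P) =
  r ≔ lit 0 ⨾ whileNZ reg (sizeRegister z) ⊖ reg r loop (compile P ⨾ r ≔ reg r ⊕ lit 1)

bound : Command → Polynomial
bound (set r e)         = con (suc (cost e))
bound (store a d e)     = con (suc (cost d + cost e))
bound (query b a)       = con 1
bound (P ⟫ Q)           = bound P :+ bound Q
bound (when e P)        = con (suc (cost e)) :+ (bound P :+ con 1)
bound (for r below z repeat P) = sizePolynomial z :* (bound P :+ con 8) :+ con 6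

-- Here `c` rounds remain and `k` are done. The counter is set to `suc k` outright rather than
-- incremented, so its value is known whatever `f` does.
iterate : ℕ → (State → State) → ℕ → ℕ → State → State
iterate r f zero    k s = s
iterate r f (suc c) k s = iterate r f c (suc k) (setReg (f s) r (suc k))

whenNZ : {A : Set} → ℕ → A → A → A
whenNZ zero    x y = x
whenNZ (suc _) x y = y

run : ∀ {n m} → Oracle n m → Command → State → State
run O (set r e)     s = setReg s r (⟦ e ⟧ s)
run O (store a d e) s = setArr s a (update (arrs s a) (⟦ d ⟧ s) (⟦ e ⟧ s))
run O (query b a)   s = setArr s b (encodeSubset (O (decodeAssignment (arrs s a))))
run O (P ⟫ Q)       s = run O Q (run O P s)
run O (when e P)    s = whenNZ (⟦ e ⟧ s) s (run O P s)
run O (for r below z repeat P) s = iterate r (run O P) (regs s (sizeRegister z)) 0 (setReg s r 0)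

-- A syntactic over-approximation with Boolean values: for a concrete command, `refl` proves that a
-- given register is untouched.
writesReg : Command → ℕ → Bool
writesReg (set r e)         x = r ≡ᵇ x
writesReg (store a d e)     x = false
writesReg (query b a)       x = false
writesReg (P ⟫ Q)           x = writesReg P x ∨ writesReg Q x
writesReg (when e P)        x = writesReg P x
writesReg (for r below z repeat P) x = (r ≡ᵇ x) ∨ writesReg P x

writesArr : Command → ℕ → Bool
writesArr (set r e)         x = false
writesArr (store a d e)     x = a ≡ᵇ x
writesArr (query b a)       x = b ≡ᵇ x
writesArr (P ⟫ Q)           x = writesArr P x ∨ writesArr Q x
writesArr (when e P)        x = writesArr P x
writesArr (for r below z repeat P) x = writesArr P x

-- Ensures that the increment in a compiled loop yields the value that `iterate` writes into the
-- counter.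
counterSafe : Command → Bool
counterSafe (P ⟫ Q)           = counterSafe P ∧ counterSafe Q
counterSafe (when e P)        = counterSafe P
counterSafe (for r below z repeat P) = not (writesReg P r) ∧ counterSafe P
counterSafe _                 = true

iterate-invariant : ∀ r f N (I : ℕ → State → Set) →
  (∀ k s → k < N → regs s r ≡ k → I k s → I (suc k) (setReg (f s) r (suc k))) →
  ∀ c k s → c + k ≡ N → regs s r ≡ k → I k s → I N (iterate r f c k s)
iterate-invariant r f N I step zero    k s refl r≡k i = i
iterate-invariant r f N I step (suc c) k s eq   r≡k i =
  iterate-invariant r f N I step c (suc k) _ (trans (+-suc c k) eq)
    (update-updates (regs (f s)) r)
    (step k s (subst (k <_) eq (s≤s (m≤n+m k c))) r≡k i)

-- Frame properties, loop invariants and running time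

module _ {n m} (O : Oracle n m) where

  regs-frame : ∀ P s x → writesReg P x ≡ false → regs (run O P s) x ≡ regs s x
  regs-frame (set r e)     s x h rewrite h = refl
  regs-frame (store a d e) s x h = refl
  regs-frame (query b a)   s x h = refl
  regs-frame (P ⟫ Q)       s x h = trans
    (regs-frame Q (run O P s) x (∨-conicalʳ (writesReg P x) _ h))
    (regs-frame P s x (∨-conicalˡ _ _ h))
  regs-frame (when e P)    s x h with ⟦ e ⟧ s
  ... | zero  = refl
  ... | suc _ = regs-frame P s x h
  regs-frame (for r below z repeat P) s x h = go (regs s (sizeRegister z)) 0 (setReg s r 0) (setReg-r s)
    where
    setReg-r : ∀ s {v} → regs (setReg s r v) x ≡ regs s x
    setReg-r s rewrite ∨-conicalˡ (r ≡ᵇ x) _ h = refl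
    go : ∀ c k s′ → regs s′ x ≡ regs s x → regs (iterate r (run O P) c k s′) x ≡ regs s x
    go zero    k s′ eq = eq
    go (suc c) k s′ eq = go c (suc k) _
      (trans (setReg-r (run O P s′)) (trans (regs-frame P s′ x (∨-conicalʳ (r ≡ᵇ x) _ h)) eq))

  arrs-frame : ∀ P s x → writesArr P x ≡ false → arrs (run O P s) x ≡ arrs s x
  arrs-frame (set r e)     s x h = refl
  arrs-frame (store a d e) s x h rewrite h = refl
  arrs-frame (query b a)   s x h rewrite h = refl
  arrs-frame (P ⟫ Q)       s x h = trans
    (arrs-frame Q (run O P s) x (∨-conicalʳ (writesArr P x) _ h))
    (arrs-frame P s x (∨-conicalˡ _ _ h))
  arrs-frame (when e P)    s x h with ⟦ e ⟧ s
  ... | zero  = refl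
  ... | suc _ = arrs-frame P s x h
  arrs-frame (for r below z repeat P) s x h = go (regs s (sizeRegister z)) 0 (setReg s r 0) refl
    where
    go : ∀ c k s′ → arrs s′ x ≡ arrs s x → arrs (iterate r (run O P) c k s′) x ≡ arrs s x
    go zero    k s′ eq = eq
    go (suc c) k s′ eq = go c (suc k) _ (trans (arrs-frame P s′ x h) eq)

  record Unchanged (P : Command) (s s′ : State) : Set where
    field
      regs≡ : ∀ x → writesReg P x ≡ false → regs s′ x ≡ regs s x
      arrs≡ : ∀ x → writesArr P x ≡ false → arrs s′ x ≡ arrs s x

  open Unchanged public

  -- The invariant is strengthened by `Unchanged`, so every round may use what was known on entry
  -- about registers and arrays that the loop never writes.
  for-invariant : ∀ r z P s N (I : ℕ → State → Set) →
    regs s (sizeRegister z) ≡ N →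
    (∀ k s′ → k < N → regs s′ r ≡ k → Unchanged (for r below z repeat P) s s′ →
      I k s′ → I (suc k) (setReg (run O P s′) r (suc k))) →
    I 0 (setReg s r 0) →
    I N (run O (for r below z repeat P) s)
  for-invariant r z P s N I size step base = proj₂
    (iterate-invariant r (run O P) N (λ k s′ → Unchanged (for r below z repeat P) s s′ × I k s′)
      (λ { k s′ k<N r≡k (u , i) →
        record
          { regs≡ = λ x h → trans (setReg-r (run O P s′) x h)
              (trans (regs-frame P s′ x (∨-conicalʳ (r ≡ᵇ x) _ h)) (regs≡ u x h))
          ; arrs≡ = λ x h → trans (arrs-frame P s′ x h) (arrs≡ u x h) }
        , step k s′ k<N r≡k u i })
      (regs s (sizeRegister z)) 0 (setReg s r 0) (trans (+-identityʳ _) size)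
      (update-updates (regs s) r)
      (record { regs≡ = setReg-r s ; arrs≡ = λ _ _ → refl } , base))
    where
    setReg-r : ∀ s {v} x → ((r ≡ᵇ x) ∨ writesReg P x) ≡ false → regs (setReg s r v) x ≡ regs s x
    setReg-r s x h rewrite ∨-conicalˡ (r ≡ᵇ x) _ h = refl

  Sized : State → Set
  Sized s = ∀ z → regs s (sizeRegister z) ≡ sizeValue z n m

  sizePolynomial-value : ∀ z → evalPoly (sizePolynomial z) n m ≡ sizeValue z n m
  sizePolynomial-value #variables = refl
  sizePolynomial-value #clauses   = refl

  Halts : Program → State → State → ℕ → Set
  Halts P s s′ b = ∃[ t ] (O ⊢ P ∶ s ⇓ s′ ⟨ t ⟩) × t ≤ b

  -- The number of rounds of each loop is `n` or `m`, read from registers that the command never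
  -- writes; nesting therefore only multiplies polynomials.
  compile-halts : ∀ P s → counterSafe P ≡ true →
    (∀ z → writesReg P (sizeRegister z) ≡ false) → Sized s →
    Halts (compile P) s (run O P s) (evalPoly (bound P) n m)
  compile-halts (set r e)     s safe keep sized = _ , ⇓assign , ≤-refl
  compile-halts (store a d e) s safe keep sized = _ , ⇓store , ≤-refl
  compile-halts (query b a)   s safe keep sized = _ , ⇓query , ≤-refl
  compile-halts (P ⟫ Q)       s safe keep sized
    with compile-halts P s (∧-conicalˡ _ _ safe) (λ z → ∨-conicalˡ _ _ (keep z)) sized
       | compile-halts Q (run O P s) (∧-conicalʳ (counterSafe P) _ safe)
           (λ z → ∨-conicalʳ (writesReg P _) _ (keep z))
           (λ z → trans (regs-frame P s _ (∨-conicalˡ _ _ (keep z))) (sized z))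
  ... | t , d , t≤ | u , e , u≤ = t + u , ⇓seq d e , +-mono-≤ t≤ u≤
  compile-halts (when e P)    s safe keep sized with ⟦ e ⟧ s in eq
  ... | zero  = _ , ⇓else eq ⇓skip , s≤s (+-monoʳ-≤ (cost e) (m≤n+m 1 _))
  ... | suc k with compile-halts P s safe keep sized
  ...   | t , d , t≤ = _ , ⇓then (λ z → contradiction (trans (sym eq) z) λ ()) d
                     , s≤s (+-monoʳ-≤ (cost e) (≤-trans t≤ (m≤m+n _ 1)))
  compile-halts (for r below z repeat P) s safe keep sized
    with go (sizeValue z n m) 0 (setReg s r 0) (+-identityʳ _) (update-updates (regs s) r)
            (λ z′ → trans (setReg-size s z′) (sized z′))
    where
    b = evalPoly (bound P) n m
    guard = reg (sizeRegister z) ⊖ reg r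
    body = compile P ⨾ r ≔ reg r ⊕ lit 1

    setReg-size : ∀ s {v} z′ → regs (setReg s r v) (sizeRegister z′) ≡ regs s (sizeRegister z′)
    setReg-size s z′ rewrite ∨-conicalˡ (r ≡ᵇ sizeRegister z′) _ (keep z′) = refl

    P-keeps-r : writesReg P r ≡ false
    P-keeps-r = not-injective (∧-conicalˡ (not (writesReg P r)) _ safe)

    -- A round takes 4 units for the guard, at most `b` for the body and 4 for the increment; the
    -- failing guard at the end takes the last 4.
    go : ∀ c k s → c + k ≡ sizeValue z n m → regs s r ≡ k → Sized s →
         Halts (whileNZ guard loop body) s (iterate r (run O P) c k s) (c * (b + 8) + 4)
    go zero k s eq r≡k sized = 4 , ⇓stop stop , ≤-refl
      where
      stop : ⟦ guard ⟧ s ≡ 0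
      stop rewrite sized z | r≡k | eq = n∸n≡0 (sizeValue z n m)
    go (suc c) k s eq r≡k sized
      with compile-halts P s (∧-conicalʳ (not (writesReg P r)) _ safe)
             (λ z′ → ∨-conicalʳ (r ≡ᵇ sizeRegister z′) _ (keep z′)) sized
         | go c (suc k) (setReg (run O P s) r (suc k)) (trans (+-suc c k) eq)
             (update-updates (regs (run O P s)) r)
             (λ z′ → trans (setReg-size (run O P s) z′) (trans (regs-frame P s _
               (∨-conicalʳ (r ≡ᵇ sizeRegister z′) _ (keep z′))) (sized z′)))
    ... | t , d , t≤ | u , e , u≤ = _ , ⇓loop continue (⇓seq d increment) e , ≤-trans
            (s≤s (+-monoʳ-≤ 3 (+-mono-≤ (+-monoˡ-≤ 4 t≤) u≤)))
            (≤-reflexive (+-*-Solver.solve 2 (λ b x → con 4 :+ₛ (b :+ₛ con 4 :+ₛ (x :+ₛ con 4))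
               := (b :+ₛ con 8) :+ₛ x :+ₛ con 4) refl b (c * (b + 8))))
      where
      open +-*-Solver using (con; _:=_) renaming (_:+_ to _:+ₛ_)
      continue : ⟦ guard ⟧ s ≢ 0
      continue rewrite sized z | r≡k | sym eq | m+n∸n≡m (suc c) k = λ ()

      increment : O ⊢ r ≔ reg r ⊕ lit 1 ∶ run O P s ⇓ setReg (run O P s) r (suc k) ⟨ 4 ⟩
      increment = subst (λ v → O ⊢ r ≔ reg r ⊕ lit 1 ∶ run O P s ⇓ setReg (run O P s) r v ⟨ 4 ⟩)
        (trans (cong (_+ 1) (trans (regs-frame P s r P-keeps-r) r≡k)) (+-comm k 1)) ⇓assign
  -- Initialising the counter takes 2 units, which turns the final 4 into the 6 of `bound`.
  ... | t , d , t≤ rewrite sized z | sizePolynomial-value z =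
    _ , ⇓seq ⇓assign d , ≤-trans (+-monoʳ-≤ 2 t≤)
      (≤-reflexive (+-*-Solver.solve 1 (λ x → con 2 :+ₛ (x :+ₛ con 4) := x :+ₛ con 6) refl _))
    where open +-*-Solver using (con; _:=_) renaming (_:+_ to _:+ₛ_)

-- Partial assignments and unit propagation

-- A pair of assignments a, b stands for the partial assignment on the
-- variables where they agree; its total extensions are the σ Between a and b.
Between : ∀ {n} → Assignment n → Assignment n → Assignment n → Set
Between a b σ = ∀ v → σ v ≡ a v ⊎ σ v ≡ b v

evalLiteral-cong : ∀ {n} {x y : Assignment n} l → x (variableOf l) ≡ y (variableOf l) →
  evalLiteral x l ≡ evalLiteral y l
evalLiteral-cong (pos i) eq = eq
evalLiteral-cong (neg i) eq = cong not eq

evalLiteral-injective : ∀ {n} {x y : Assignment n} l → evalLiteral x l ≡ evalLiteral y l →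
  x (variableOf l) ≡ y (variableOf l)
evalLiteral-injective (pos i) eq = eq
evalLiteral-injective (neg i) eq = not-injective eq

evalLiteral-between-false : ∀ {n} {a b σ : Assignment n} → Between a b σ → ∀ l →
  evalLiteral a l ≡ false → evalLiteral b l ≡ false → evalLiteral σ l ≡ false
evalLiteral-between-false btw l ha hb with btw (variableOf l)
... | inj₁ eq = trans (evalLiteral-cong l eq) ha
... | inj₂ eq = trans (evalLiteral-cong l eq) hb

-- `σ` may follow `a` at one variable and `b` at another. This is harmless, since a clause false at
-- both has every single literal false at both.
any-between-false : ∀ {n} {a b σ : Assignment n} → Between a b σ → ∀ ls →
  any (evalLiteral a) ls ≡ false → any (evalLiteral b) ls ≡ false →
  any (evalLiteral σ) ls ≡ false
any-between-false btw []       ha hb = refl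
any-between-false btw (l ∷ ls) ha hb = cong₂ _∨_
  (evalLiteral-between-false btw l (∨-conicalˡ _ _ ha) (∨-conicalˡ _ _ hb))
  (any-between-false btw ls (∨-conicalʳ (evalLiteral _ l) _ ha) (∨-conicalʳ (evalLiteral _ l) _ hb))

-- Replacing `a` by `splice v b a` in the pair of `a` and `b` assigns to `v` the value it has in `b`
-- and leaves all other variables as they were.
splice : ∀ {n} → Fin n → Assignment n → Assignment n → Assignment n
splice v b a u = if does (u ≟ v) then b u else a u

splice-at : ∀ {n} (v : Fin n) b a → splice v b a v ≡ b v
splice-at v b a with v ≟ v
... | yes _  = refl
... | no v≢v = contradiction refl v≢v

splice-between : ∀ {n} (v : Fin n) a b → Between a b (splice v b a)
splice-between v a b u with does (u ≟ v)
... | true  = inj₂ refl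
... | false = inj₁ refl

splice-cong : ∀ {n} (v : Fin n) {a b a′ b′} → a′ ≗ a → b′ ≗ b → splice v b′ a′ ≗ splice v b a
splice-cong v a≗ b≗ u with does (u ≟ v)
... | true  = b≗ u
... | false = a≗ u

unassigned : ∀ {n} → Assignment n → Assignment n → ℕ
unassigned {zero}  a b = 0
unassigned {suc n} a b =
  (if does (a zero ≟ᵇ b zero) then 0 else 1) + unassigned (a ∘ suc) (b ∘ suc)

unassigned≤n : ∀ {n} (a b : Assignment n) → unassigned a b ≤ n
unassigned≤n {zero}  a b = z≤n
unassigned≤n {suc n} a b with does (a zero ≟ᵇ b zero)
... | true  = m≤n⇒m≤1+n (unassigned≤n _ _)
... | false = s≤s (unassigned≤n _ _)

unassigned≡0⇒≗ : ∀ {n} (a b : Assignment n) → unassigned a b ≡ 0 → a ≗ b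
unassigned≡0⇒≗ a b eq zero    with a zero ≟ᵇ b zero
... | yes p = p
unassigned≡0⇒≗ a b eq (suc v) = unassigned≡0⇒≗ (a ∘ suc) (b ∘ suc) (m+n≡0⇒n≡0 _ eq) v

unassigned-mono : ∀ {n} (a b a′ b′ : Assignment n) → (∀ v → a v ≡ b v → a′ v ≡ b′ v) →
  unassigned a′ b′ ≤ unassigned a b
unassigned-mono {zero}  a b a′ b′ h = z≤n
unassigned-mono {suc n} a b a′ b′ h = +-mono-≤ head (unassigned-mono _ _ _ _ (h ∘ suc))
  where
  head : (if does (a′ zero ≟ᵇ b′ zero) then 0 else 1) ≤ (if does (a zero ≟ᵇ b zero) then 0 else 1)
  head with a zero ≟ᵇ b zero | a′ zero ≟ᵇ b′ zero
  ... | _     | yes _ = z≤n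
  ... | yes p | no q  = contradiction (h zero p) q
  ... | no _  | no _  = ≤-refl

unassigned-strict : ∀ {n} (a b a′ b′ : Assignment n) → (∀ v → a v ≡ b v → a′ v ≡ b′ v) →
  ∀ v → a v ≢ b v → a′ v ≡ b′ v → unassigned a′ b′ < unassigned a b
unassigned-strict a b a′ b′ h zero    p q
  with a zero ≟ᵇ b zero | a′ zero ≟ᵇ b′ zero
... | yes r | _     = contradiction r p
... | no _  | no r  = contradiction q r
... | no _  | yes _ = s≤s (unassigned-mono _ _ _ _ (h ∘ suc))
unassigned-strict a b a′ b′ h (suc v) p q
  with a zero ≟ᵇ b zero | a′ zero ≟ᵇ b′ zero
... | yes r | no s  = contradiction (h zero r) s
... | yes _ | yes _ = unassigned-strict _ _ _ _ (h ∘ suc) v p q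
... | no _  | yes _ = m<n⇒m<1+n (unassigned-strict _ _ _ _ (h ∘ suc) v p q)
... | no _  | no _  = s≤s (unassigned-strict _ _ _ _ (h ∘ suc) v p q)

module _ {n m} (Φ : Formula n m) where

  Conflict : Assignment n → Assignment n → Set
  Conflict a b = ∃[ j ] evalClause a (Φ j) ≡ false × evalClause b (Φ j) ≡ false

  Conflict-between : ∀ {a b a′ b′} → Between a b a′ → Between a b b′ →
    Conflict a b → Conflict a′ b′
  Conflict-between h h′ (j , p , q) =
    j , any-between-false h (literals (Φ j)) p q , any-between-false h′ (literals (Φ j)) p q

  Conflict-cong : ∀ {a b a′ b′} → a′ ≗ a → b′ ≗ b → Conflict a b → Conflict a′ b′
  Conflict-cong h h′ = Conflict-between (inj₁ ∘ h) (inj₂ ∘ h′)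

  Conflict-sym : ∀ {a b} → Conflict a b → Conflict b a
  Conflict-sym = Conflict-between (λ _ → inj₂ refl) (λ _ → inj₁ refl)

  Conflict⇒¬Satisfies : ∀ {a b σ} → Between a b σ → Conflict a b → ¬ Satisfies Φ σ
  Conflict⇒¬Satisfies h (j , p , q) sat =
    contradiction (trans (sym (sat j)) (any-between-false h (literals (Φ j)) p q)) λ ()

  -- Propagation has nothing to do at `v`: neither of the two values falsifies a clause at once. The
  -- first pair gives `v` its value in `b`, the second its value in `a`.
  Stable : Fin n → Assignment n → Assignment n → Set
  Stable v a b = a v ≢ b v → ¬ Conflict (splice v b a) b × ¬ Conflict a (splice v a b)

  Stable-cong : ∀ {v a b a′ b′} → a′ ≗ a → b′ ≗ b → Stable v a b → Stable v a′ b′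
  Stable-cong {v} p q st a′≢b′
    with st (λ eq → a′≢b′ (trans (p v) (trans eq (sym (q v)))))
  ... | ¬c , ¬d = ¬c ∘ Conflict-cong (sym ∘ splice-cong v p q) (sym ∘ q)
                , ¬d ∘ Conflict-cong (sym ∘ p) (sym ∘ splice-cong v q p)

  -- On an assigned variable σ follows a; on the others, the given model τ.
  -- A clause with an assigned literal is satisfied by it, as otherwise its
  -- other literal would be forced.
  stable-extension : ∀ {a b τ} → Is2SAT Φ → Satisfies Φ τ → ¬ Conflict a b →
    (∀ v → Stable v a b) → ∃[ σ ] Satisfies Φ σ × Between a b σ
  stable-extension {a} {b} {τ} two sat ¬conflict stable = σ , σ-sat , σ-between
    where
    σ : Assignment n
    σ v = if does (a v ≟ᵇ b v) then a v else τ v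

    σ-between : Between a b σ
    σ-between v with a v ≟ᵇ b v
    ... | yes _  = inj₁ refl
    ... | no a≢b with τ v ≟ᵇ a v
    ...   | yes p = inj₁ p
    ...   | no p  = inj₂ (trans (¬-not p) (sym (¬-not (a≢b ∘ sym))))

    fixed-or-open : ∀ l → evalLiteral σ l ≡ false →
      (evalLiteral a l ≡ false × evalLiteral b l ≡ false) ⊎
      (a (variableOf l) ≢ b (variableOf l) × evalLiteral τ l ≡ false)
    fixed-or-open l h with a (variableOf l) ≟ᵇ b (variableOf l) in eq
    ... | yes a≡b = inj₁ (a-false , trans (evalLiteral-cong l (sym a≡b)) a-false)
      where
      a-false : evalLiteral a l ≡ false
      a-false = trans (evalLiteral-cong l
        (sym (cong (λ d → if does d then a (variableOf l) else τ (variableOf l)) eq))) h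
    ... | no a≢b  = inj₂ (a≢b , trans (evalLiteral-cong l
        (sym (cong (λ d → if does d then a (variableOf l) else τ (variableOf l)) eq))) h)

    open-false : ∀ l → a (variableOf l) ≢ b (variableOf l) →
      evalLiteral a l ≡ false ⊎ evalLiteral b l ≡ false
    open-false l a≢b with evalLiteral a l ≟ᵇ false | evalLiteral b l ≟ᵇ false
    ... | yes p | _     = inj₁ p
    ... | no _  | yes q = inj₂ q
    ... | no p  | no q  = contradiction
      (evalLiteral-injective l (trans (¬-not p) (sym (¬-not q)))) a≢b

    -- One of `a`, `b` falsifies `k`; fixing its variable at that value falsifies both literals at
    -- both ends, against stability. The clause enters only through the last argument, so both
    -- orders of its literals are served.
    not-forced : ∀ l k → evalLiteral a l ≡ false → evalLiteral b l ≡ false →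
      a (variableOf k) ≢ b (variableOf k) →
      ¬ (∀ {x y} → evalLiteral x l ≡ false → evalLiteral x k ≡ false →
                   evalLiteral y l ≡ false → evalLiteral y k ≡ false → Conflict x y)
    not-forced l k la lb a≢b conflict with open-false k a≢b
    ... | inj₁ ka = proj₂ (stable v a≢b) (conflict la ka
            (evalLiteral-between-false (splice-between v b a) l lb la)
            (trans (evalLiteral-cong k (splice-at v a b)) ka))
      where v = variableOf k
    ... | inj₂ kb = proj₁ (stable v a≢b) (conflict
            (evalLiteral-between-false (splice-between v a b) l la lb)
            (trans (evalLiteral-cong k (splice-at v b a)) kb) lb kb)
      where v = variableOf k

    both : ∀ {p q} → p ≡ false → q ≡ false → p ∨ (q ∨ false) ≡ false
    both refl refl = refl

    clause-sat : ∀ ls → length ls ≤ 2 →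
      (∀ {x y} → any (evalLiteral x) ls ≡ false → any (evalLiteral y) ls ≡ false → Conflict x y) →
      any (evalLiteral τ) ls ≡ true → any (evalLiteral σ) ls ≢ false
    -- An empty clause is excluded by the type of `τ-true`.
    clause-sat (l ∷ []) _ conflict τ-true σ-false
      with fixed-or-open l (∨-conicalˡ _ _ σ-false)
    ... | inj₁ (la , lb) = ¬conflict (conflict (cong (_∨ false) la) (cong (_∨ false) lb))
    ... | inj₂ (_ , lτ)  = contradiction (trans (sym τ-true) (cong (_∨ false) lτ)) λ ()
    clause-sat (l ∷ k ∷ []) _ conflict τ-true σ-false
      with fixed-or-open l (∨-conicalˡ _ _ σ-false)
         | fixed-or-open k (∨-conicalˡ _ _ (∨-conicalʳ (evalLiteral σ l) _ σ-false))
    ... | inj₁ (la , lb)  | inj₁ (ka , kb)  = ¬conflict (conflict (both la ka) (both lb kb))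
    ... | inj₁ (la , lb)  | inj₂ (k≢ , _)   = not-forced l k la lb k≢
      λ xl xk yl yk → conflict (both xl xk) (both yl yk)
    ... | inj₂ (l≢ , _)   | inj₁ (ka , kb)  = not-forced k l ka kb l≢
      λ xk xl yk yl → conflict (both xl xk) (both yl yk)
    ... | inj₂ (_ , lτ)   | inj₂ (_ , kτ)   =
      contradiction (trans (sym τ-true) (both lτ kτ)) λ ()
    clause-sat (_ ∷ _ ∷ _ ∷ _) (s≤s (s≤s ())) _ _ _

    σ-sat : Satisfies Φ σ
    σ-sat j = ¬-not (clause-sat (literals (Φ j)) (two j) (λ p q → j , p , q) (sat j))

  -- Single propagation steps

  Shrinks : Assignment n → Assignment n → Assignment n → Assignment n → Set
  Shrinks a b a′ b′ = ∀ σ → Between a′ b′ σ → Between a b σ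

  -- Counterpart of `Shrinks`: only forced values were assigned. It lets a conflict found after
  -- propagation refute every model of the choices made before.
  KeepsModels : Assignment n → Assignment n → Assignment n → Assignment n → Set
  KeepsModels a b a′ b′ = ∀ σ → Satisfies Φ σ → Between a b σ → Between a′ b′ σ

  -- The value of `v` in `b` is tried; a conflict rules it out, and `v` takes its value in `a`. If
  -- `v` is already assigned, both cases of `here` give the same value.
  record HalfStep (v : Fin n) (a b a′ b′ : Assignment n) : Set where
    field
      fixed  : a′ ≗ a
      others : ∀ u → u ≢ v → b′ u ≡ b u
      here   : (Conflict (splice v b a) b × b′ v ≡ a v) ⊎
               (¬ Conflict (splice v b a) b × b′ v ≡ b v)

  module _ {v a b a′ b′} (step : HalfStep v a b a′ b′) where
    open HalfStep step

    new-value : ∀ u → b′ u ≡ b u ⊎ (u ≡ v × b′ u ≡ a u × Conflict (splice v b a) b)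
    new-value u with u ≟ v | here
    ... | no u≢v   | _            = inj₁ (others u u≢v)
    ... | yes refl | inj₁ (c , p) = inj₂ (refl , p , c)
    ... | yes refl | inj₂ (_ , p) = inj₁ p

    half-shrinks : Shrinks a b a′ b′
    half-shrinks σ h u with h u | new-value u
    ... | inj₁ p | _                = inj₁ (trans p (fixed u))
    ... | inj₂ p | inj₁ q           = inj₂ (trans p q)
    ... | inj₂ p | inj₂ (_ , q , _) = inj₁ (trans p q)

    half-keeps-models : KeepsModels a b a′ b′
    half-keeps-models σ sat h u with h u | new-value u
    ... | inj₁ p | _                   = inj₁ (trans p (sym (fixed u)))
    ... | inj₂ p | inj₁ q              = inj₂ (trans p (sym q))
    ... | inj₂ p | inj₂ (refl , q , c) =
      contradiction sat (Conflict⇒¬Satisfies between c)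
      where
      -- A model with the tested value at `u` lies between the tested pair, whose conflict excludes
      -- it.
      between : Between (splice u b a) b σ
      between w with w ≟ u
      ... | yes refl = inj₁ p
      ... | no _     = h w

    half-agree : ∀ u → a u ≡ b u → a′ u ≡ b′ u
    half-agree u eq with new-value u
    ... | inj₁ p           = trans (fixed u) (trans eq (sym p))
    ... | inj₂ (_ , p , _) = trans (fixed u) (sym p)

    -- Only a conflict at an unassigned `v` has an effect, and it assigns `v`, so the number of
    -- unassigned variables measures progress.
    half-progress : (a′ ≗ a × b′ ≗ b × (a v ≢ b v → ¬ Conflict (splice v b a) b)) ⊎
      (a v ≢ b v × Conflict (splice v b a) b × unassigned a′ b′ < unassigned a b)
    half-progress with a v ≟ᵇ b v | here
    ... | yes p | _            = inj₁ (fixed , same , λ a≢b → contradiction p a≢b)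
      where
      same : b′ ≗ b
      same u with new-value u
      ... | inj₁ q              = q
      ... | inj₂ (refl , q , _) = trans q p
    ... | no p  | inj₁ (c , q) = inj₂ (p , c ,
      unassigned-strict a b a′ b′ half-agree v p (trans (fixed v) (sym q)))
    ... | no p  | inj₂ (¬c , q) = inj₁ (fixed , same , λ _ → ¬c)
      where
      same : b′ ≗ b
      same u with new-value u
      ... | inj₁ r              = r
      ... | inj₂ (_ , _ , c)    = contradiction c ¬c

  unassigned-sym : ∀ (a b : Assignment n) → unassigned a b ≤ unassigned b a
  unassigned-sym a b = unassigned-mono b a a b (λ _ → sym)

  Between-sym : ∀ {a b σ : Assignment n} → Between a b σ → Between b a σ
  Between-sym h v with h v
  ... | inj₁ p = inj₂ p
  ... | inj₂ p = inj₁ p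

  record Step (v : Fin n) (a b a′ b′ : Assignment n) : Set where
    field
      shrinks      : Shrinks a b a′ b′
      keeps-models : KeepsModels a b a′ b′
      progress     : (a′ ≗ a × b′ ≗ b × Stable v a b) ⊎
                     (¬ Stable v a b × unassigned a′ b′ < unassigned a b)

  -- The second half runs with the roles exchanged and so tests the other value. If the first half
  -- changed nothing, the second test concerns the original pair up to pointwise equality, and its
  -- verdict supplies the other component of stability.
  step-of-halves : ∀ {v a b a′ b′ a″ b″} →
    HalfStep v a b a′ b′ → HalfStep v b′ a′ b″ a″ → Step v a b a″ b″
  step-of-halves {v} {a} {b} {a′} {b′} {a″} {b″} h k = record
    { shrinks      = λ σ → half-shrinks h σ ∘ Between-sym ∘ half-shrinks k σ ∘ Between-sym
    ; keeps-models = λ σ sat → Between-sym ∘ half-keeps-models k σ sat ∘ Between-sym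
                             ∘ half-keeps-models h σ sat
    ; progress     = progress }
    where
    decrease : unassigned b″ a″ ≤ unassigned b′ a′ → unassigned a″ b″ ≤ unassigned a′ b′
    decrease p = ≤-trans (unassigned-sym a″ b″) (≤-trans p (unassigned-sym b′ a′))

    progress : (a″ ≗ a × b″ ≗ b × Stable v a b) ⊎
               (¬ Stable v a b × unassigned a″ b″ < unassigned a b)
    progress with half-progress h | half-progress k
    ... | inj₂ (a≢b , c , lt) | _ = inj₂
      ( (λ st → proj₁ (st a≢b) c)
      , ≤-<-trans (decrease (unassigned-mono b′ a′ b″ a″ (half-agree k))) lt )
    ... | inj₁ (p , q , ¬c) | inj₁ (r , t , ¬d) = inj₁
      ( (λ u → trans (t u) (p u)) , (λ u → trans (r u) (q u))
      , λ a≢b → ¬c a≢b , λ d → ¬d (λ eq → a≢b (sym (trans (sym (q v)) (trans eq (p v)))))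
          (Conflict-cong (splice-cong v q p) p (Conflict-sym d)) )
    ... | inj₁ (p , q , ¬c) | inj₂ (b≢a , d , lt) = inj₂
      ( (λ st → proj₂ (st (λ eq → b≢a (trans (q v) (trans (sym eq) (sym (p v))))))
          (Conflict-sym (Conflict-cong (sym ∘ splice-cong v q p) (sym ∘ p) d)))
      , ≤-trans (s≤s (unassigned-sym a″ b″)) (≤-trans lt
          (≤-trans (unassigned-sym b′ a′) (unassigned-mono a b a′ b′ (half-agree h)))) )

  -- Stability after `n` passes

  AllStable : Assignment n → Assignment n → Set
  AllStable a b = ∀ v → Stable v a b

  -- k counts completed passes, i the steps of the current one.
  Progress : ℕ → Assignment n → Assignment n → Set
  Progress k a b = AllStable a b ⊎ unassigned a b + k ≤ n

  PartialProgress : ℕ → ℕ → Assignment n → Assignment n → Set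
  PartialProgress k i a b = Progress (suc k) a b ⊎
    (unassigned a b + k ≤ n × ∀ v → toℕ v < i → Stable v a b)

  -- One newly assigned variable pays for the whole pass. A step that assigns none keeps the earlier
  -- variables stable and adds `v` to them.
  advance : ∀ {k v a b a′ b′} → Step v a b a′ b′ →
    PartialProgress k (toℕ v) a b → PartialProgress k (suc (toℕ v)) a′ b′
  advance {k} {v} {a} {b} {a′} {b′} step pp with Step.progress step | pp
  ... | inj₁ (p , q , _)  | inj₁ (inj₁ st) = inj₁ (inj₁ λ u → Stable-cong p q (st u))
  ... | inj₁ (p , q , _)  | inj₁ (inj₂ le) = inj₁ (inj₂
    (≤-trans (+-monoˡ-≤ (suc k) (unassigned-mono a b a′ b′ λ u eq → trans (p u) (trans eq (sym (q u))))) le))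
  ... | inj₁ (p , q , stv) | inj₂ (le , st) = inj₂
    ( ≤-trans (+-monoˡ-≤ k (unassigned-mono a b a′ b′ λ u eq → trans (p u) (trans eq (sym (q u))))) le
    , λ u u<1+v → Stable-cong p q (before u (m<1+n⇒m<n∨m≡n u<1+v)) )
    where
    before : ∀ u → toℕ u < toℕ v ⊎ toℕ u ≡ toℕ v → Stable u a b
    before u (inj₁ u<v) = st u u<v
    before u (inj₂ u≡v) = subst (λ w → Stable w a b) (sym (toℕ-injective u≡v)) stv
  ... | inj₂ (unst , _)  | inj₁ (inj₁ st) = contradiction (st v) unst
  ... | inj₂ (_ , lt)    | inj₁ (inj₂ le) = inj₁ (inj₂ (≤-trans (+-monoˡ-≤ (suc k) (<⇒≤ lt)) le))
  ... | inj₂ (_ , lt)    | inj₂ (le , _)  = inj₁ (inj₂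
    (≤-trans (≤-reflexive (+-suc _ k)) (≤-trans (+-monoˡ-≤ k lt) le)))

  pass-completed : ∀ {k a b} → PartialProgress k n a b → Progress (suc k) a b
  pass-completed (inj₁ p)        = p
  pass-completed (inj₂ (_ , st)) = inj₁ λ v → st v (toℕ<n v)

  -- Every pass that does not end in stability has assigned a variable. After `n` such passes none
  -- is left unassigned, and stability is vacuous.
  n-passes-stable : ∀ {a b} → Progress n a b → AllStable a b
  n-passes-stable         (inj₁ st)    = st
  n-passes-stable {a} {b} (inj₂ le) v a≢b = contradiction
    (unassigned≡0⇒≗ a b (n≤0⇒n≡0 (+-cancelʳ-≤ n _ 0 le)) v) a≢b

-- The algorithm

-- Registers: 0, 1 hold n, m; 2, 3, 4, 5 count decided variables, passes,
-- variables and clauses; 6 receives the outcome of a conflict test; 7 is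
-- temporary.  Arrays: 0 holds the decided values, 1 and 2 the pair
-- representing the partial assignment, 3 and 4 the oracle's answers.

-- On bits, `p ∸ (1 ∸ q)` is their conjunction, so register 6 counts the clauses present in both
-- answers.
tallyClause tally : Command
tallyClause = set 6 (reg 6 ⊕ (arr 3 (reg 5) ⊖ (lit 1 ⊖ arr 4 (reg 5))))
tally       = for 5 below #clauses repeat tallyClause

conflict : ℕ → ℕ → Command
conflict a b = (query 3 a ⟫ query 4 b ⟫ set 6 (lit 0)) ⟫ tally

-- half a b tests the value which b gives to variable number reg 4; if it
-- leads to a conflict, the variable becomes assigned as in a.  It does nothing
-- to an assigned variable.
restore : ℕ → ℕ → Command
restore a b = when (reg 6) (store b (reg 4) (reg 7)) ⟫ store a (reg 4) (reg 7)

half : ℕ → ℕ → Command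
half a b =
  set 7 (arr a (reg 4)) ⟫ store a (reg 4) (arr b (reg 4)) ⟫
  conflict a b ⟫ restore a b

pass propagate loadVariable load decide decisions search : Command
pass      = for 4 below #variables repeat (half 1 2 ⟫ half 2 1)
propagate = for 3 below #variables repeat pass
-- Variables up to and including number `reg 2` get equal values in both arrays; later ones get
-- opposite values, which marks them as unassigned.
loadVariable =
  store 1 (reg 4) (arr 0 (reg 4)) ⟫ store 2 (reg 4) (arr 0 (reg 4)) ⟫
  when (reg 4 ⊖ reg 2) (store 2 (reg 4) (lit 1 ⊖ arr 0 (reg 4)))
load      = for 4 below #variables repeat loadVariable
-- The tentative 1 gives way to `1 ∸ reg 6`, which is 0 as soon as there is a conflict, however
-- large the count.
decide    =
  store 0 (reg 2) (lit 1) ⟫ load ⟫ propagate ⟫ conflict 1 2 ⟫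
  store 0 (reg 2) (lit 1 ⊖ reg 6)
decisions = for 2 below #variables repeat decide
-- An assignment paired with itself conflicts exactly when it violates a clause.
search    = decisions ⟫ conflict 0 0

-- Correctness of the conflict test and of a half step

encodeSubset-lookup : ∀ {m} (p : Subset m) j →
  encodeSubset p (toℕ j) ≡ (if lookup p j then 1 else 0)
encodeSubset-lookup (b ∷ p) zero    = refl
encodeSubset-lookup (b ∷ p) (suc j) = encodeSubset-lookup p j

module _ {n m} (Φ : Formula n m) where

  private
    O = violated Φ

  value : State → ℕ → Assignment n
  value s a = decodeAssignment (arrs s a)

  violated-lookup : ∀ x j →
    encodeSubset (O x) (toℕ j) ≡ (if not (evalClause x (Φ j)) then 1 else 0)
  violated-lookup x j = trans (encodeSubset-lookup (O x) j)
    (cong (if_then 1 else 0) (lookup∘tabulate _ j))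

  -- The flag is a count of clauses, so only its being zero or nonzero carries meaning.
  ConflictFlag : ℕ → Assignment n → Assignment n → Set
  ConflictFlag f a b = (f ≡ 0 × ¬ Conflict Φ a b) ⊎ (f ≢ 0 × Conflict Φ a b)

  conflict-spec : ∀ a b s → regs s 1 ≡ m → writesArr (conflict a b) b ≡ false →
    ConflictFlag (regs (run O (conflict a b) s) 6) (value s a) (value s b)
  conflict-spec a b s size keep = finish
    (for-invariant O 5 #clauses tallyClause s₁ m I size step (inj₁ (refl , λ _ ())))
    where
    x = value s a
    y = value s b
    s₁ = run O (query 3 a ⟫ query 4 b ⟫ set 6 (lit 0)) s

    Both : Fin m → Set
    Both j = evalClause x (Φ j) ≡ false × evalClause y (Φ j) ≡ false

    I : ℕ → State → Set
    I k s′ = (regs s′ 6 ≡ 0 × ∀ j → toℕ j < k → ¬ Both j) ⊎ (regs s′ 6 ≢ 0 × Conflict Φ x y)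

    -- The second query is submitted after array 3 was overwritten; `keep` ensures that `b` is not
    -- array 3 and is still intact.
    answer₄ : arrs s₁ 4 ≡ encodeSubset (O y)
    answer₄ = cong (encodeSubset ∘ O ∘ decodeAssignment)
      (cong (if_then encodeSubset (O x) else arrs s b) (∨-conicalˡ (3 ≡ᵇ b) _ (∨-conicalˡ _ _ keep)))

    gain : ∀ j → let p = evalClause x (Φ j); q = evalClause y (Φ j) in
      ((if not p then 1 else 0) ∸ (1 ∸ (if not q then 1 else 0)) ≡ 0 × ¬ Both j) ⊎
      ((if not p then 1 else 0) ∸ (1 ∸ (if not q then 1 else 0)) ≡ 1 × Both j)
    gain j with evalClause x (Φ j) | evalClause y (Φ j)
    ... | true  | true  = inj₁ (refl , λ { (() , _) })
    ... | true  | false = inj₁ (refl , λ { (() , _) })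
    ... | false | true  = inj₁ (refl , λ { (_ , ()) })
    ... | false | false = inj₂ (refl , refl , refl)

    step : ∀ k s′ → k < m → regs s′ 5 ≡ k → Unchanged O tally s₁ s′ →
           I k s′ → I (suc k) (setReg (run O tallyClause s′) 5 (suc k))
    step k s′ k<m r≡k u i = extend i (gain j)
      where
      j = fromℕ< k<m
      j≡k = toℕ-fromℕ< k<m
      p = evalClause x (Φ j)
      q = evalClause y (Φ j)
      g = (if not p then 1 else 0) ∸ (1 ∸ (if not q then 1 else 0))

      read : ∀ c z → arrs s′ c ≡ encodeSubset (O z) →
        arrs s′ c (regs s′ 5) ≡ (if not (evalClause z (Φ j)) then 1 else 0)
      read c z eq = trans (cong-app eq (regs s′ 5))
        (trans (cong (encodeSubset (O z)) (trans r≡k (sym j≡k))) (violated-lookup z j))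

      flag≡ : regs s′ 6 + (arrs s′ 3 (regs s′ 5) ∸ (1 ∸ arrs s′ 4 (regs s′ 5))) ≡ regs s′ 6 + g
      flag≡ = cong₂ (λ p q → regs s′ 6 + (p ∸ (1 ∸ q)))
        (read 3 x (arrs≡ u 3 refl)) (read 4 y (trans (arrs≡ u 4 refl) answer₄))

      extend : I k s′ → (g ≡ 0 × ¬ Both j) ⊎ (g ≡ 1 × Both j) →
               I (suc k) (setReg (run O tallyClause s′) 5 (suc k))
      extend (inj₂ (f≢0 , c)) _ = inj₂ ((λ eq → f≢0 (m+n≡0⇒m≡0 (regs s′ 6) eq)) , c)
      extend (inj₁ (f≡0 , ¬c)) (inj₁ (g≡0 , ¬d)) =
        inj₁ (trans flag≡ (cong₂ _+_ f≡0 g≡0) , λ i i<1+k → before i (m<1+n⇒m<n∨m≡n i<1+k))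
        where
        before : ∀ i → toℕ i < k ⊎ toℕ i ≡ k → ¬ Both i
        before i (inj₁ i<k) = ¬c i i<k
        before i (inj₂ i≡k) = subst (¬_ ∘ Both) (sym (toℕ-injective (trans i≡k (sym j≡k)))) ¬d
      extend (inj₁ _) (inj₂ (g≡1 , d)) = inj₂
        ( (λ eq → contradiction (trans (sym g≡1) (m+n≡0⇒n≡0 (regs s′ 6) (trans (sym flag≡) eq))) λ ())
        , j , d )

    finish : ∀ {f} → (f ≡ 0 × ∀ j → toℕ j < m → ¬ Both j) ⊎ (f ≢ 0 × Conflict Φ x y) →
      ConflictFlag f x y
    finish (inj₁ (f≡0 , ¬c)) = inj₁ (f≡0 , λ { (j , d) → ¬c j (toℕ<n j) d })
    finish (inj₂ p)          = inj₂ p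

  half-spec : ∀ a b v s → regs s 1 ≡ m → regs s 4 ≡ toℕ v → a ≢ b →
    writesArr (conflict a b) a ≡ false → writesArr (conflict a b) b ≡ false →
    let s′ = run O (half a b) s in
    HalfStep Φ v (value s a) (value s b) (value s′ a) (value s′ b)
  half-spec a b v s size r≡v a≢b keep-a keep-b = finish (run O (conflict a b) s₂)
    (trans (regs-frame O (conflict a b) s₂ 4 refl) r≡v)
    (trans (regs-frame O (conflict a b) s₂ 7 refl) (cong f r≡v))
    (trans (arrs-frame O (conflict a b) s₂ a keep-a) a₂)
    (trans (arrs-frame O (conflict a b) s₂ b keep-b) b₂)
    (conflict-spec a b s₂ size keep-b)
    where
    f = arrs s a
    g = arrs s b
    i = toℕ v
    s₂ = run O (set 7 (arr a (reg 4)) ⟫ store a (reg 4) (arr b (reg 4))) s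

    a₂ : arrs s₂ a ≡ update f i (g i)
    a₂ = trans (update-updates (arrs s) a) (cong (λ i → update f i (g i)) r≡v)

    b₂ : arrs s₂ b ≡ g
    b₂ = update-minimal (arrs s) a≢b

    b-same : value s₂ b ≗ value s b
    b-same u = cong (λ h → 0 <ᵇ h (toℕ u)) b₂

    -- Copying the cell of `v` from array `b` to array `a` produces exactly the pair that a half
    -- step has to test.
    trial : value s₂ a ≗ splice v (value s b) (value s a)
    trial u with u ≟ v
    ... | yes refl = cong (0 <ᵇ_) (trans (cong-app a₂ i) (update-updates f i))
    ... | no u≢v   = cong (0 <ᵇ_) (trans (cong-app a₂ (toℕ u))
                       (update-minimal f (u≢v ∘ sym ∘ toℕ-injective)))

    finish : ∀ s₃ → regs s₃ 4 ≡ i → regs s₃ 7 ≡ f i →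
      arrs s₃ a ≡ update f i (g i) → arrs s₃ b ≡ g →
      ConflictFlag (regs s₃ 6) (value s₂ a) (value s₂ b) →
      let s′ = run O (restore a b) s₃ in
      HalfStep Φ v (value s a) (value s b) (value s′ a) (value s′ b)
    finish s₃ r4 r7 a₃ b₃ flag = go (regs s₃ 6) flag
      where
      s₄ : ℕ → State
      s₄ c = whenNZ c s₃ (setArr s₃ b (update (arrs s₃ b) (regs s₃ 4) (regs s₃ 7)))

      restored : ∀ s₄ → regs s₄ 4 ≡ i → regs s₄ 7 ≡ f i → arrs s₄ a ≡ update f i (g i) →
        (∀ u → u ≢ v → value s₄ b u ≡ value s b u) →
        (Conflict Φ (splice v (value s b) (value s a)) (value s b) × value s₄ b v ≡ value s a v) ⊎
        (¬ Conflict Φ (splice v (value s b) (value s a)) (value s b) × value s₄ b v ≡ value s b v) →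
        let s′ = run O (store a (reg 4) (reg 7)) s₄ in
        HalfStep Φ v (value s a) (value s b) (value s′ a) (value s′ b)
      restored s₄ r4 r7 a₄ others here = record
        { fixed  = fixed
        ; others = λ u u≢v → trans (b-kept u) (others u u≢v)
        ; here   = map⊎ (map₂ (trans (b-kept v))) (map₂ (trans (b-kept v))) here }
        where
        s′ = run O (store a (reg 4) (reg 7)) s₄

        b-kept : ∀ u → value s′ b u ≡ value s₄ b u
        b-kept u = cong (λ h → 0 <ᵇ h (toℕ u)) (update-minimal (arrs s₄) a≢b)

        a′ : arrs s′ a ≡ update (update f i (g i)) i (f i)
        a′ = trans (update-updates (arrs s₄) a)
          (trans (cong₂ (update (arrs s₄ a)) r4 r7) (cong (λ h → update h i (f i)) a₄))

        fixed : value s′ a ≗ value s a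
        fixed u with v ≟ u
        ... | yes refl = cong (0 <ᵇ_) (trans (cong-app a′ i) (update-updates (update f i (g i)) i))
        ... | no v≢u   = cong (0 <ᵇ_) (trans (cong-app a′ (toℕ u))
          (trans (update-minimal (update f i (g i)) (v≢u ∘ toℕ-injective))
                 (update-minimal f (v≢u ∘ toℕ-injective))))

      -- The flag is a separate argument, so that matching on it reduces the `whenNZ` inside `s₄ c`.
      go : ∀ c → ConflictFlag c (value s₂ a) (value s₂ b) →
        let s′ = run O (store a (reg 4) (reg 7)) (s₄ c) in
        HalfStep Φ v (value s a) (value s b) (value s′ a) (value s′ b)
      go zero    (inj₂ (0≢0 , _)) = contradiction refl 0≢0
      go (suc _) (inj₁ (() , _))
      go zero    (inj₁ (_ , ¬c))  = restored s₃ r4 r7 a₃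
        (λ u _ → cong (λ h → 0 <ᵇ h (toℕ u)) b₃)
        (inj₂ (¬c ∘ Conflict-cong Φ trial b-same , cong (λ h → 0 <ᵇ h i) b₃))
      go (suc c) (inj₂ (_ , cf))  = restored (s₄ (suc c)) r4 r7
        (trans (update-minimal (arrs s₃) (a≢b ∘ sym)) a₃)
        (λ u u≢v → cong (0 <ᵇ_) (trans (cong-app b₄ (toℕ u))
          (update-minimal g (u≢v ∘ sym ∘ toℕ-injective))))
        (inj₁ (Conflict-cong Φ (sym ∘ trial) (sym ∘ b-same) cf
              , cong (0 <ᵇ_) (trans (cong-app b₄ i) (update-updates g i))))
        where
        b₄ : arrs (s₄ (suc c)) b ≡ update g i (f i)
        b₄ = trans (update-updates (arrs s₃) b)
          (trans (cong₂ (update (arrs s₃ b)) r4 r7) (cong (λ h → update h i (f i)) b₃))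

  -- An opaque copy of run: comparing states must not unfold whole programs.
  opaque
    exec : Command → State → State
    exec = run O

    exec≡run : exec ≡ run O
    exec≡run = refl

  via-exec : ∀ {ℓ} (Q : (Command → State → State) → Set ℓ) → Q (run O) → Q exec
  via-exec Q = subst Q (sym exec≡run)

  exec-⟫ : ∀ P Q s → exec (P ⟫ Q) s ≡ exec Q (exec P s)
  exec-⟫ P Q s = via-exec (λ e → e (P ⟫ Q) s ≡ e Q (e P s)) refl

  exec-regs : ∀ P s x → writesReg P x ≡ false → regs (exec P s) x ≡ regs s x
  exec-regs P s x h = via-exec (λ e → regs (e P s) x ≡ regs s x) (regs-frame O P s x h)

  exec-arrs : ∀ P s x → writesArr P x ≡ false → arrs (exec P s) x ≡ arrs s x
  exec-arrs P s x h = via-exec (λ e → arrs (e P s) x ≡ arrs s x) (arrs-frame O P s x h)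

  exec-for : ∀ r z P s N (I : ℕ → State → Set) →
    regs s (sizeRegister z) ≡ N →
    (∀ k s′ → k < N → regs s′ r ≡ k → Unchanged O (for r below z repeat P) s s′ →
      I k s′ → I (suc k) (setReg (exec P s′) r (suc k))) →
    I 0 (setReg s r 0) →
    I N (exec (for r below z repeat P) s)
  exec-for r z P s N I size = via-exec
    (λ e → (∀ k s′ → k < N → regs s′ r ≡ k → Unchanged O (for r below z repeat P) s s′ →
              I k s′ → I (suc k) (setReg (e P s′) r (suc k))) →
           I 0 (setReg s r 0) → I N (e (for r below z repeat P) s))
    (for-invariant O r z P s N I size)

  exec-conflict : ∀ a b s → regs s 1 ≡ m → writesArr (conflict a b) b ≡ false →
    ConflictFlag (regs (exec (conflict a b) s) 6) (value s a) (value s b)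
  exec-conflict a b s size keep = via-exec
    (λ e → ConflictFlag (regs (e (conflict a b) s) 6) (value s a) (value s b))
    (conflict-spec a b s size keep)

  exec-half : ∀ a b v s → regs s 1 ≡ m → regs s 4 ≡ toℕ v → a ≢ b →
    writesArr (conflict a b) a ≡ false → writesArr (conflict a b) b ≡ false →
    let s′ = exec (half a b) s in
    HalfStep Φ v (value s a) (value s b) (value s′ a) (value s′ b)
  exec-half a b v s size r≡v a≢b keep-a keep-b = via-exec
    (λ e → HalfStep Φ v (value s a) (value s b)
             (value (e (half a b) s) a) (value (e (half a b) s) b))
    (half-spec a b v s size r≡v a≢b keep-a keep-b)

  -- Correctness of propagation

  Refines : State → State → Set
  Refines s s′ = Shrinks Φ (value s 1) (value s 2) (value s′ 1) (value s′ 2) ×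
                 KeepsModels Φ (value s 1) (value s 2) (value s′ 1) (value s′ 2)

  Refines-refl : ∀ {s} → Refines s s
  Refines-refl = (λ _ h → h) , (λ _ _ h → h)

  Refines-trans : ∀ {s s′ s″} → Refines s s′ → Refines s′ s″ → Refines s s″
  Refines-trans (p , q) (p′ , q′) =
    (λ σ → p σ ∘ p′ σ) , (λ σ sat → q′ σ sat ∘ q σ sat)

  halves-spec : ∀ v s → regs s 1 ≡ m → regs s 4 ≡ toℕ v →
    let s′ = exec (half 1 2 ⟫ half 2 1) s in
    Step Φ v (value s 1) (value s 2) (value s′ 1) (value s′ 2)
  halves-spec v s size r≡v =
    subst (λ s′ → Step Φ v (value s 1) (value s 2) (value s′ 1) (value s′ 2))
      (sym (exec-⟫ (half 1 2) (half 2 1) s))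
      (step-of-halves Φ
        (exec-half 1 2 v s size r≡v (λ ()) refl refl)
        (exec-half 2 1 v s₁ (trans (exec-regs (half 1 2) s 1 refl) size)
          (trans (exec-regs (half 1 2) s 4 refl) r≡v) (λ ()) refl refl))
    where s₁ = exec (half 1 2) s

  pass-spec : ∀ k s → regs s 0 ≡ n → regs s 1 ≡ m →
    Progress Φ k (value s 1) (value s 2) →
    let s′ = exec pass s in
    Refines s s′ × Progress Φ (suc k) (value s′ 1) (value s′ 2)
  pass-spec k s size₀ size₁ prog = map₂ (pass-completed Φ)
    (exec-for 4 #variables (half 1 2 ⟫ half 2 1) s n I size₀ step
      (Refines-refl {s} , initially prog))
    where
    I : ℕ → State → Set
    I i s′ = Refines s s′ × PartialProgress Φ k i (value s′ 1) (value s′ 2)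

    initially : Progress Φ k (value s 1) (value s 2) →
                PartialProgress Φ k 0 (value s 1) (value s 2)
    initially (inj₁ st) = inj₁ (inj₁ st)
    initially (inj₂ le) = inj₂ (le , λ _ ())

    step : ∀ i s′ → i < n → regs s′ 4 ≡ i → Unchanged O pass s s′ → I i s′ →
           I (suc i) (setReg (exec (half 1 2 ⟫ half 2 1) s′) 4 (suc i))
    step i s′ i<n r≡i u (ref , pp) =
        Refines-trans {s} {s′} {exec (half 1 2 ⟫ half 2 1) s′} ref
          (Step.shrinks halves , Step.keeps-models halves)
      , subst (λ i → PartialProgress Φ k (suc i) _ _) v≡i
          (advance Φ halves (subst (λ i → PartialProgress Φ k i _ _) (sym v≡i) pp))
      where
      v = fromℕ< i<n
      v≡i = toℕ-fromℕ< i<n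
      halves = halves-spec v s′ (trans (regs≡ u 1 refl) size₁) (trans r≡i (sym v≡i))

  propagate-spec : ∀ s → regs s 0 ≡ n → regs s 1 ≡ m →
    let s′ = exec propagate s in
    Refines s s′ × AllStable Φ (value s′ 1) (value s′ 2)
  propagate-spec s size₀ size₁ = map₂ (n-passes-stable Φ)
    (exec-for 3 #variables pass s n I size₀ step
      (Refines-refl {s} , inj₂ (≤-trans (≤-reflexive (+-identityʳ _)) (unassigned≤n _ _))))
    where
    I : ℕ → State → Set
    I k s′ = Refines s s′ × Progress Φ k (value s′ 1) (value s′ 2)

    step : ∀ k s′ → k < n → regs s′ 3 ≡ k → Unchanged O propagate s s′ → I k s′ →
           I (suc k) (setReg (exec pass s′) 3 (suc k))
    step k s′ k<n r≡k u (ref , prog) =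
      map₁ (Refines-trans {s} {s′} {exec pass s′} ref)
        (pass-spec k s′ (trans (regs≡ u 0 refl) size₀) (trans (regs≡ u 1 refl) size₁) prog)

  -- Loading the decided values and deciding a variable

  Loaded : ℕ → State → State → Fin n → Set
  Loaded i s s′ u =
    value s′ 1 u ≡ value s 0 u ×
    (toℕ u ≤ i → value s′ 2 u ≡ value s 0 u) ×
    (i < toℕ u → value s′ 2 u ≡ not (value s 0 u))

  load-spec : ∀ s → regs s 0 ≡ n → ∀ u → Loaded (regs s 2) s (exec load s) u
  load-spec s size₀ u = exec-for 4 #variables loadVariable s n I size₀ step (λ _ ()) u (toℕ<n u)
    where
    I : ℕ → State → Set
    I k s′ = ∀ u → toℕ u < k → Loaded (regs s 2) s s′ u

    step : ∀ k s′ → k < n → regs s′ 4 ≡ k → Unchanged O load s s′ → I k s′ →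
           I (suc k) (setReg (exec loadVariable s′) 4 (suc k))
    step k s′ k<n r≡k un i u u<1+k = via-exec (λ e → Loaded (regs s 2) s (e loadVariable s′) u)
      (go (m<1+n⇒m<n∨m≡n u<1+k))
      where
      s₁ = run O (store 1 (reg 4) (arr 0 (reg 4)) ⟫ store 2 (reg 4) (arr 0 (reg 4))) s′

      arrs₀ : arrs s′ 0 ≡ arrs s 0
      arrs₀ = arrs≡ un 0 refl

      x₀ = arrs s′ 0 (regs s′ 4)
      f₁ = arrs s′ 1
      f₂ = arrs s′ 2
      f₂′ = update f₂ (regs s′ 4) x₀

      miss : toℕ u < k → ∀ f x → update f (regs s′ 4) x (toℕ u) ≡ f (toℕ u)
      miss u<k f x = update-minimal f (λ eq → <⇒≢ u<k (trans (sym eq) r≡k))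

      hit : toℕ u ≡ k → ∀ f x → update f (regs s′ 4) x (toℕ u) ≡ x
      hit u≡k f x = trans (cong (update f (regs s′ 4) x) (trans u≡k (sym r≡k)))
        (update-updates f (regs s′ 4))

      source : toℕ u ≡ k → arrs s′ 0 (regs s′ 4) ≡ arrs s 0 (toℕ u)
      source u≡k = trans (cong-app arrs₀ _) (cong (arrs s 0) (trans r≡k (sym u≡k)))

      flip-bit : ∀ x → (0 <ᵇ (1 ∸ x)) ≡ not (0 <ᵇ x)
      flip-bit zero    = refl
      flip-bit (suc x) = cong (0 <ᵇ_) (0∸n≡0 x)

      when-loading : ∀ c → c ≡ regs s′ 4 ∸ regs s′ 2 →
        toℕ u < k ⊎ toℕ u ≡ k →
        Loaded (regs s 2) s
          (whenNZ c s₁ (run O (store 2 (reg 4) (lit 1 ⊖ arr 0 (reg 4))) s₁)) u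
      when-loading zero    c≡ (inj₁ u<k) =
          trans (cong (0 <ᵇ_) (miss u<k f₁ x₀)) (proj₁ (i u u<k))
        , trans (cong (0 <ᵇ_) (miss u<k f₂ x₀)) ∘ proj₁ (proj₂ (i u u<k))
        , trans (cong (0 <ᵇ_) (miss u<k f₂ x₀)) ∘ proj₂ (proj₂ (i u u<k))
      when-loading (suc c) c≡ (inj₁ u<k) =
          trans (cong (0 <ᵇ_) (miss u<k f₁ x₀)) (proj₁ (i u u<k))
        , trans (cong (0 <ᵇ_) missed-twice) ∘ proj₁ (proj₂ (i u u<k))
        , trans (cong (0 <ᵇ_) missed-twice) ∘ proj₂ (proj₂ (i u u<k))
        where
        missed-twice = trans (miss u<k f₂′ (1 ∸ x₀)) (miss u<k f₂ x₀)
      when-loading zero    c≡ (inj₂ u≡k) =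
          cong (0 <ᵇ_) (trans (hit u≡k f₁ x₀) (source u≡k))
        , (λ _ → cong (0 <ᵇ_) (trans (hit u≡k f₂ x₀) (source u≡k)))
        , (λ lt → contradiction (subst₂ _≤_ (trans r≡k (sym u≡k)) (regs≡ un 2 refl)
                    (m∸n≡0⇒m≤n (sym c≡))) (<⇒≱ lt))
      when-loading (suc c) c≡ (inj₂ u≡k) =
          cong (0 <ᵇ_) (trans (hit u≡k f₁ x₀) (source u≡k))
        , (λ le → contradiction (trans c≡ (m≤n⇒m∸n≡0
                    (subst₂ _≤_ (trans u≡k (sym r≡k)) (sym (regs≡ un 2 refl)) le))) λ ())
        , (λ _ → trans (cong (0 <ᵇ_) (trans (hit u≡k f₂′ (1 ∸ x₀)) (cong (1 ∸_) (source u≡k))))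
                       (flip-bit (arrs s 0 (toℕ u))))

      go : toℕ u < k ⊎ toℕ u ≡ k → Loaded (regs s 2) s (run O loadVariable s′) u
      go = when-loading _ refl

  Extends : Assignment n → ℕ → Assignment n → Set
  Extends σ i x = ∀ u → toℕ u < i → x u ≡ σ u

  -- Beyond `i` the two arrays hold opposite bits, so any value of `σ` there agrees with one of
  -- them.
  loaded⇒between : ∀ {i s s′ σ} → (∀ u → Loaded i s s′ u) → Extends σ (suc i) (value s 0) →
    Between (value s′ 1) (value s′ 2) σ
  loaded⇒between {i} {s} {s′} {σ} loaded ext u with loaded u | <-≤-connex i (toℕ u)
  ... | p , _ , _ | inj₂ u≤i = inj₁ (trans (sym (ext u (s≤s u≤i))) (sym p))
  ... | p , _ , q | inj₁ i<u with σ u ≟ᵇ value s 0 u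
  ...   | yes r = inj₁ (trans r (sym p))
  ...   | no r  = inj₂ (trans (¬-not r) (sym (q i<u)))

  between⇒extends : ∀ {i s s′ σ} → (∀ u → Loaded i s s′ u) →
    Between (value s′ 1) (value s′ 2) σ → Extends σ (suc i) (value s 0)
  between⇒extends loaded btw u u<1+i with loaded u | btw u
  ... | p , _ , _ | inj₁ r = trans (sym p) (sym r)
  ... | _ , q , _ | inj₂ r = trans (sym (q (s≤s⁻¹ u<1+i))) (sym r)

  ExtendsToModel : ℕ → Assignment n → Set
  ExtendsToModel i x = ∃[ σ ] Satisfies Φ σ × Extends σ i x

  Extends-suc : ∀ {σ} i {x} → x i ≡ σ i → (∀ u → u ≢ i → toℕ u < toℕ i → x u ≡ σ u) →
    Extends σ (suc (toℕ i)) x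
  Extends-suc i here before u u<1+i with u ≟ i
  ... | yes refl = here
  ... | no u≢i   = before u u≢i (≤∧≢⇒< (s≤s⁻¹ u<1+i) (u≢i ∘ toℕ-injective))

  -- Without a conflict, `stable-extension` yields a model between the propagated pair, and
  -- shrinking places it among the extensions of the choices with `x_i` true. With a conflict, the
  -- old model `σ` has `x_i` false, as otherwise propagation would have kept it between a
  -- conflicting pair.
  decide-spec : Is2SAT Φ → ∀ i s → regs s 0 ≡ n → regs s 1 ≡ m → regs s 2 ≡ toℕ i →
    ExtendsToModel (toℕ i) (value s 0) →
    ExtendsToModel (suc (toℕ i)) (value (exec decide s) 0)
  decide-spec two i s size₀ size₁ r≡i (σ , sat , ext) =
    subst (ExtendsToModel (suc (toℕ i)) ∘ λ s′ → value s′ 0) (sym decide≡)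
      (conclude (regs s₄ 6) refl flag)
    where
    s₁ = run O (store 0 (reg 2) (lit 1)) s
    s₂ = exec load s₁
    s₃ = exec propagate s₂
    s₄ = exec (conflict 1 2) s₃
    s₅ = run O (store 0 (reg 2) (lit 1 ⊖ reg 6)) s₄

    decide≡ : exec decide s ≡ s₅
    decide≡ = via-exec (λ e → e decide s ≡ run O (store 0 (reg 2) (lit 1 ⊖ reg 6))
      (e (conflict 1 2) (e propagate (e load s₁)))) refl

    loaded : ∀ u → Loaded (toℕ i) s₁ s₂ u
    loaded = subst (λ k → ∀ u → Loaded k s₁ s₂ u) r≡i (load-spec s₁ size₀)

    size₂ : regs s₂ 1 ≡ m
    size₂ = trans (exec-regs load s₁ 1 refl) size₁

    propagated : Refines s₂ s₃ × AllStable Φ (value s₃ 1) (value s₃ 2)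
    propagated = propagate-spec s₂ (trans (exec-regs load s₁ 0 refl) size₀) size₂

    flag : ConflictFlag (regs s₄ 6) (value s₃ 1) (value s₃ 2)
    flag = exec-conflict 1 2 s₃ (trans (exec-regs propagate s₂ 1 refl) size₂) refl

    r₄ : regs s₄ 2 ≡ toℕ i
    r₄ = trans (exec-regs (conflict 1 2) s₃ 2 refl)
      (trans (exec-regs propagate s₂ 2 refl) (trans (exec-regs load s₁ 2 refl) r≡i))

    arrs₄ : arrs s₄ 0 ≡ arrs s₁ 0
    arrs₄ = trans (exec-arrs (conflict 1 2) s₃ 0 refl)
      (trans (exec-arrs propagate s₂ 0 refl) (exec-arrs load s₁ 0 refl))

    value₁-at : value s₁ 0 i ≡ true
    value₁-at = cong (0 <ᵇ_) (trans (cong (λ k → update (arrs s 0) k 1 (toℕ i)) r≡i)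
      (update-updates (arrs s 0) (toℕ i)))

    value₁-off : ∀ u → u ≢ i → value s₁ 0 u ≡ value s 0 u
    value₁-off u u≢i = cong (0 <ᵇ_) (trans (cong (λ k → update (arrs s 0) k 1 (toℕ u)) r≡i)
      (update-minimal (arrs s 0) (u≢i ∘ sym ∘ toℕ-injective)))

    value₅-at : value s₅ 0 i ≡ (0 <ᵇ (1 ∸ regs s₄ 6))
    value₅-at = cong (0 <ᵇ_)
      (trans (cong (λ k → update (arrs s₄ 0) k (1 ∸ regs s₄ 6) (toℕ i)) r₄)
        (update-updates (arrs s₄ 0) (toℕ i)))

    value₅-off : ∀ u → u ≢ i → value s₅ 0 u ≡ value s₁ 0 u
    value₅-off u u≢i = cong (0 <ᵇ_)
      (trans (cong (λ k → update (arrs s₄ 0) k (1 ∸ regs s₄ 6) (toℕ u)) r₄)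
        (trans (update-minimal (arrs s₄ 0) (u≢i ∘ sym ∘ toℕ-injective))
          (cong-app arrs₄ (toℕ u))))

    conclude : ∀ f → regs s₄ 6 ≡ f → ConflictFlag f (value s₃ 1) (value s₃ 2) →
               ExtendsToModel (suc (toℕ i)) (value s₅ 0)
    conclude f eq (inj₁ (refl , ¬c)) =
      map₂ (λ {ρ} → map₂ (λ btw → accept ρ (between⇒extends {s = s₁} {s₂} loaded
                                (proj₁ (proj₁ propagated) ρ btw))))
        (stable-extension Φ two sat ¬c (proj₂ propagated))
      where
      accept : ∀ ρ → Extends ρ (suc (toℕ i)) (value s₁ 0) → Extends ρ (suc (toℕ i)) (value s₅ 0)
      accept ρ ext₁ = Extends-suc i
        (trans (trans value₅-at (cong (λ f → 0 <ᵇ (1 ∸ f)) eq))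
               (trans (sym value₁-at) (ext₁ i ≤-refl)))
        (λ u u≢i u<i → trans (value₅-off u u≢i) (ext₁ u (m<n⇒m<1+n u<i)))
    conclude zero    eq (inj₂ (0≢0 , _)) = contradiction refl 0≢0
    conclude (suc f) eq (inj₂ (_ , c)) = σ , sat , Extends-suc i
      (trans value₅-at (trans (cong (0 <ᵇ_) (trans (cong (1 ∸_) eq) (0∸n≡0 f)))
        (sym (¬-not σi≢true))))
      (λ u u≢i u<i → trans (value₅-off u u≢i) (trans (value₁-off u u≢i) (ext u u<i)))
      where
      σi≢true : σ i ≢ true
      σi≢true σi = Conflict⇒¬Satisfies Φ
        (proj₂ (proj₁ propagated) σ sat (loaded⇒between {s = s₁} {s₂} loaded (Extends-suc i
          (trans value₁-at (sym σi))
          (λ u u≢i u<i → trans (value₁-off u u≢i) (ext u u<i))))) c sat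

  decisions-spec : Is2SAT Φ → Satisfiable Φ → ∀ s → regs s 0 ≡ n → regs s 1 ≡ m →
    ExtendsToModel n (value (exec decisions s) 0)
  decisions-spec two (τ , sat) s size₀ size₁ =
    exec-for 2 #variables decide s n I size₀ step (τ , sat , λ _ ())
    where
    I : ℕ → State → Set
    I i s′ = ExtendsToModel i (value s′ 0)

    step : ∀ k s′ → k < n → regs s′ 2 ≡ k → Unchanged O decisions s s′ → I k s′ →
           I (suc k) (setReg (exec decide s′) 2 (suc k))
    step k s′ k<n r≡k u ih =
      subst (λ k → I (suc k) (exec decide s′)) i≡k
        (decide-spec two i s′ (trans (regs≡ u 0 refl) size₀) (trans (regs≡ u 1 refl) size₁)
          (trans r≡k (sym i≡k)) (subst (λ k → I k s′) (sym i≡k) ih))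
      where
      i = fromℕ< k<n
      i≡k = toℕ-fromℕ< k<n

  -- The answer and the total running time

  ¬Conflict-diagonal : ∀ {x} → ¬ Conflict Φ x x → Satisfies Φ x
  ¬Conflict-diagonal ¬c j = ¬-not λ eq → ¬c (j , eq , eq)

  -- A passed final test certifies a positive answer by itself. A failed one refutes satisfiability,
  -- since after `n` decisions array 0 would otherwise agree with a model at every variable.
  search-correct : Is2SAT Φ → ∀ s → regs s 0 ≡ n → regs s 1 ≡ m →
    let s′ = exec search s in CorrectOutput Φ (setReg s′ 0 (1 ∸ regs s′ 6))
  search-correct two s size₀ size₁ =
    subst (λ s′ → CorrectOutput Φ (setReg s′ 0 (1 ∸ regs s′ 6)))
      (sym (exec-⟫ decisions (conflict 0 0) s))
      (conclude (regs s₂ 6) refl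
        (exec-conflict 0 0 s₁ (trans (exec-regs decisions s 1 refl) size₁) refl))
    where
    s₁ = exec decisions s
    s₂ = exec (conflict 0 0) s₁

    unchanged : value s₂ 0 ≗ value s₁ 0
    unchanged u = cong (λ h → 0 <ᵇ h (toℕ u)) (exec-arrs (conflict 0 0) s₁ 0 refl)

    conclude : ∀ f → regs s₂ 6 ≡ f → ConflictFlag f (value s₁ 0) (value s₁ 0) →
      CorrectOutput Φ (setReg s₂ 0 (1 ∸ regs s₂ 6))
    conclude f eq (inj₁ (refl , ¬c)) =
      (λ _ → cong (1 ∸_) eq , satisfied) , λ unsat → contradiction (_ , satisfied) unsat
      where
      satisfied : Satisfies Φ (value s₂ 0)
      satisfied = ¬Conflict-diagonal (¬c ∘ Conflict-cong Φ (sym ∘ unchanged) (sym ∘ unchanged))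
    conclude zero    eq (inj₂ (0≢0 , _)) = contradiction refl 0≢0
    conclude (suc f) eq (inj₂ (_ , c))   =
      (λ sat → contradiction c (no-conflict (decisions-spec two sat s size₀ size₁))) ,
      (λ _ → trans (cong (1 ∸_) eq) (0∸n≡0 f))
      where
      no-conflict : ExtendsToModel n (value s₁ 0) → ¬ Conflict Φ (value s₁ 0) (value s₁ 0)
      no-conflict (σ , sat , ext) c =
        Conflict⇒¬Satisfies Φ (λ u → inj₁ (sym (ext u (toℕ<n u)))) c sat

  exec-halts : ∀ P s → counterSafe P ≡ true →
    (∀ z → writesReg P (sizeRegister z) ≡ false) → Sized O s →
    Halts O (compile P) s (exec P s) (evalPoly (bound P) n m)
  exec-halts P s safe keep sized =
    via-exec (λ e → Halts O (compile P) s (e P s) (evalPoly (bound P) n m))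
      (compile-halts O P s safe keep sized)

  -- Register 0 serves as a loop bound and must stay fixed during the search, so the answer is
  -- written by one last assignment outside the command, at a cost of 4 units.
  output : ∀ {P s s′ b} → Halts O P s s′ b → CorrectOutput Φ (setReg s′ 0 (1 ∸ regs s′ 6)) →
    ∃[ s″ ] ∃[ t ] (O ⊢ P ⨾ 0 ≔ lit 1 ⊖ reg 6 ∶ s ⇓ s″ ⟨ t ⟩) × t ≤ b + 4 × CorrectOutput Φ s″
  output (t , halts , t≤) correct = _ , _ , ⇓seq halts ⇓assign , +-monoˡ-≤ 4 t≤ , correct

corollary1 : Σ[ P ∈ Program ] Σ[ p ∈ Polynomial ]
    ((n m : ℕ) (Φ : Formula n m) → Is2SAT Φ →
    ∃[ s ] ∃[ t ] (violated Φ ⊢ P ∶ initial n m ⇓ s ⟨ t ⟩)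
    × t ≤ evalPoly p n m
    × CorrectOutput Φ s)
corollary1 = (compile search ⨾ 0 ≔ lit 1 ⊖ reg 6) , bound search :+ con 4 ,
  λ n m Φ two → output Φ
    -- Counter safety and preservation of the size registers are computed from the syntax of
    -- `search`.
    (exec-halts Φ search (initial n m) refl (λ { #variables → refl ; #clauses → refl })
      (λ { #variables → refl ; #clauses → refl }))
    (search-correct Φ two (initial n m) refl refl)
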